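{- Let $\mathcal{S}$ be a structural couniform abstract logic in a propositional language $\mathcal{L}$. Then its Lindenbaum atlas $\mathbf{Lin}_{\mathcal{S}}[\Sigma_{\mathcal{S}}]$ is couniform.
   Context: $\mathcal{L}$ is an abstract propositional language, given by a set $\mathcal{V}_{\mathcal{L}}$ of variables, a set of constants and a set of finitary connectives. $\mathbf{Fm}_{\mathcal{L}}$ is the set of all $\mathcal{L}$-formulae, also viewed as the formula algebra; $\mathcal{V}(\alpha)$ is the set of variables occurring in $\alpha$, and $\mathcal{V}(X)=\bigcup_{\alpha\in X}\mathcal{V}(\alpha)$ for $X\subseteq\mathbf{Fm}_{\mathcal{L}}$. A structural abstract logic $\mathcal{S}$ is given by a (not necessarily finitary) consequence relation $\vdash_{\mathcal{S}}$ on $\mathbf{Fm}_{\mathcal{L}}$ (reflexive, monotone, transitive/closed under cut) closed under substitutions, equivalently by its consequence operator $\mathbf{Cn}_{\mathcal{S}}(X)=\{\alpha : X\vdash_{\mathcal{S}}\alpha\}$. A set $X$ is consistent if $\mathbf{Cn}_{\mathcal{S}}(X)\neq\mathbf{Fm}_{\mathcal{L}}$. An $\mathcal{S}$-theory is a set $X$ with $\mathbf{Cn}_{\mathcal{S}}(X)=X$; $\Sigma_{\mathcal{S}}$ is the set of all $\mathcal{S}$-theories. $\mathcal{S}$ is couniform if for any collection $\{X_i\}_{i\in I}$ of formula sets with $\mathcal{V}(X_i)\cap\mathcal{V}(X_{i'})=\varnothing$ for $i\neq i'$ and $\mathcal{V}(\bigcup_{i\in I}X_i)\neq\mathcal{V}_{\mathcal{L}}$: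 if $\bigcup_{i\in I}X_i$ is inconsistent, then at least one $X_i$ is inconsistent. An $\mathcal{L}$-matrix is a pair $\mathbf{M}=\langle\mathbf{A},D\rangle$ with $\mathbf{A}$ an algebra of the signature of $\mathcal{L}$ and $D\subseteq|\mathbf{A}|$ (its logical filter). A valuation in $\mathbf{A}$ is a homomorphism from the formula algebra to $\mathbf{A}$. $\mathfrak{S}(\mathbf{M})$ is the set of all $X\subseteq\mathbf{Fm}_{\mathcal{L}}$ such that $X=\{\alpha\in\mathbf{Fm}_{\mathcal{L}} : v[\alpha]\in D\}$ for some valuation $v$ in $\mathbf{A}$. An atlas is a pair $\langle\mathbf{A},\{D_i\}_{i\in I}\rangle$ with each $D_i\subseteq|\mathbf{A}|$; its corresponding bundle is the family of matrices $\{\langle\mathbf{A},D_i\rangle\}_{i\in I}$. The Lindenbaum atlas of $\mathcal{S}$ is $\mathbf{Lin}_{\mathcal{S}}[\Sigma_{\mathcal{S}}]=\langle\mathbf{Fm}_{\mathcal{L}},\Sigma_{\mathcal{S}}\rangle$. A nonempty set $\{\mathbf{M}_j\}_{j\in J}$ of $\mathcal{L}$-matrices is couniform if for any collection $\{X_i\}_{i\in I}$ of formula sets with $\mathcal{V}(X_i)\cap\mathcal{V}(X_{i'})=\varnothing$ for $i\neq i'$ and $\mathcal{V}(\bigcup_{i\in I}X_i)\neq\mathcal{V}_{\mathcal{L}}$: if for every $i\in I$ there are $j\in J$ and $Z_j\in\mathfrak{S}(\mathbf{M}_j)$ with $X_i\subseteq Z_j\subsetneq\mathbf{Fm}_{\mathcal{L}}$,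 then there are $k\in J$ and $Z_k\in\mathfrak{S}(\mathbf{M}_k)$ with $\bigcup_{i\in I}X_i\subseteq Z_k\subsetneq\mathbf{Fm}_{\mathcal{L}}$. An atlas is couniform if its corresponding bundle is couniform. -}

module Defs where

open import Level using (Level; suc; _⊔_)
open import Data.Nat.Base using (ℕ)
open import Data.Product.Base using (Σ; Σ-syntax; ∃-syntax; _×_; proj₁)
open import Data.Vec.Base using (Vec; map)
open import Data.Vec.Relation.Unary.Any using (Any)
open import Relation.Nullary.Negation.Core using (¬_)
open import Relation.Binary.PropositionalEquality.Core using (_≡_; _≢_)
open import Relation.Unary using (Pred; _∈_; _⊆_; _⊂_; _≐_; _∩_; ⋃; U; Empty)

-- One universe level ℓ is used for the language, for sets of formulae, for
-- consequence and for the index types of unions, so that Cn X and ⋃ I X are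
-- again sets of formulae of the same kind.

record Language (ℓ : Level) : Set (suc ℓ) where
  field
    Variable   : Set ℓ
    Constant   : Set ℓ
    Connective : Set ℓ
    arity      : Connective → ℕ

module _ {ℓ : Level} (L : Language ℓ) where
  open Language L

  data Formula : Set ℓ where
    var : Variable → Formula
    con : Constant → Formula
    app : (f : Connective) → Vec Formula (arity f) → Formula

  FormulaSet : Set (suc ℓ)
  FormulaSet = Pred Formula ℓ

  data _OccursIn_ (p : Variable) : Formula → Set ℓ where
    here  : p OccursIn var p
    there : ∀ {f αs} → Any (p OccursIn_) αs → p OccursIn app f αs

  Vars : FormulaSet → Pred Variable ℓ
  Vars X p = ∃[ α ] (α ∈ X × p OccursIn α)

  record Algebra : Set (suc ℓ) where
    field
      Carrier : Set ℓ
      conᴬ    : Constant → Carrier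
      appᴬ    : (f : Connective) → Vec Carrier (arity f) → Carrier

  formulaAlgebra : Algebra
  formulaAlgebra = record { Carrier = Formula ; conᴬ = con ; appᴬ = app }

  record Valuation (A : Algebra) : Set ℓ where
    open Algebra A
    field
      ⟦_⟧   : Formula → Carrier
      ⟦con⟧ : ∀ c → ⟦ con c ⟧ ≡ conᴬ c
      ⟦app⟧ : ∀ f αs → ⟦ app f αs ⟧ ≡ appᴬ f (map ⟦_⟧ αs)

  Substitution : Set ℓ
  Substitution = Valuation formulaAlgebra

  image : Substitution → FormulaSet → FormulaSet
  image σ X β = ∃[ α ] (α ∈ X × β ≡ Valuation.⟦_⟧ σ α)

  record AbstractLogic : Set (suc ℓ) where
    infix 4 _⊢_
    field
      _⊢_        : FormulaSet → Formula → Set ℓ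
      reflexive  : ∀ {X α} → α ∈ X → X ⊢ α
      monotone   : ∀ {X Y α} → X ⊆ Y → X ⊢ α → Y ⊢ α
      transitive : ∀ {X Y α} → (∀ {β} → β ∈ Y → X ⊢ β) → Y ⊢ α → X ⊢ α

    Cn : FormulaSet → FormulaSet
    Cn X α = X ⊢ α

    Inconsistent : FormulaSet → Set ℓ
    Inconsistent X = Cn X ≐ U

    IsTheory : FormulaSet → Set ℓ
    IsTheory X = Cn X ≐ X

    Theory : Set (suc ℓ)
    Theory = Σ FormulaSet IsTheory

  IsStructural : AbstractLogic → Set (suc ℓ)
  IsStructural S = ∀ (σ : Substitution) {X α} →
    X ⊢ α → image σ X ⊢ Valuation.⟦_⟧ σ α
    where open AbstractLogic S

  PairwiseVarDisjoint : {I : Set ℓ} → (I → FormulaSet) → Set ℓ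
  PairwiseVarDisjoint X = ∀ {i i′} → i ≢ i′ → Empty (Vars (X i) ∩ Vars (X i′))

  IsCouniformLogic : AbstractLogic → Set (suc ℓ)
  IsCouniformLogic S = (I : Set ℓ) (X : I → FormulaSet) →
    PairwiseVarDisjoint X →
    ¬ (Vars (⋃ I X) ≐ U) →
    Inconsistent (⋃ I X) →
    ∃[ i ] Inconsistent (X i)
    where open AbstractLogic S

  record Matrix : Set (suc ℓ) where
    field
      algebra : Algebra
      filter  : Pred (Algebra.Carrier algebra) ℓ

  𝔖 : Matrix → Pred FormulaSet ℓ
  𝔖 M X = Σ[ v ∈ Valuation algebra ] (X ≐ (λ α → Valuation.⟦_⟧ v α ∈ filter))
    where open Matrix M

  -- The first component says that the set of matrices is nonempty.
  IsCouniformFamily : ∀ {j} {J : Set j} → (J → Matrix) → Set (suc ℓ ⊔ j)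
  IsCouniformFamily {J = J} M = J × ((I : Set ℓ) (X : I → FormulaSet) →
    PairwiseVarDisjoint X →
    ¬ (Vars (⋃ I X) ≐ U) →
    (∀ i → ∃[ j ] ∃[ Z ] (Z ∈ 𝔖 (M j) × X i ⊆ Z × Z ⊂ U)) →
    ∃[ k ] ∃[ Z ] (Z ∈ 𝔖 (M k) × ⋃ I X ⊆ Z × Z ⊂ U))

  record Atlas (j : Level) : Set (suc (ℓ ⊔ j)) where
    field
      algebra : Algebra
      Index   : Set j
      filter  : Index → Pred (Algebra.Carrier algebra) ℓ

    bundle : Index → Matrix
    bundle i = record { algebra = algebra ; filter = filter i }

  IsCouniformAtlas : ∀ {j} → Atlas j → Set (suc ℓ ⊔ j)
  IsCouniformAtlas A = IsCouniformFamily (Atlas.bundle A)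

  lindenbaumAtlas : AbstractLogic → Atlas (suc ℓ)
  lindenbaumAtlas S = record
    { algebra = formulaAlgebra
    ; Index   = AbstractLogic.Theory S
    ; filter  = proj₁
    }

{-# OPTIONS --safe #-}
-- The preimage of a theory under a substitution is closed under consequence by
-- structurality, so a set contained in a proper such preimage is consistent.
-- Couniformity of the logic then makes ⋃ I X consistent, and Cn (⋃ I X), taken
-- with the identity substitution, is the required proper set.
module Submission where

open import Level using (Level)
open import Data.Product.Base using (_,_)
open import Data.Unit.Base using (tt)
open import Data.Unit.Polymorphic.Base using (⊤)
open import Data.Vec.Properties using (map-id)
open import Function.Base using (id)
open import Relation.Nullary.Negation.Core using (¬_)
open import Relation.Binary.PropositionalEquality.Core using (refl; sym; cong)
open import Relation.Unary using (_∈_; _⊆_; _⊂_; ⋃; U)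
open import Defs

module _ {ℓ : Level} (L : Language ℓ) where

  identitySubstitution : Substitution L
  identitySubstitution = record
    { ⟦_⟧   = id
    ; ⟦con⟧ = λ _ → refl
    ; ⟦app⟧ = λ f αs → cong (app f) (sym (map-id αs))
    }

  module _ (S : AbstractLogic L) where
    open AbstractLogic S

    Cn-isTheory : ∀ X → IsTheory (Cn X)
    Cn-isTheory X = transitive id , reflexive

    module _ (structural : IsStructural L S) where

      -- `σ` carries a derivation from `X` to one from `image σ X`, which lies inside `T`, and `T`
      -- contains its own consequences.
      preimage-closed : ∀ (σ : Substitution L) ((T , _) : Theory) {X} →
        X ⊆ (λ α → Valuation.⟦_⟧ σ α ∈ T) →
        Cn X ⊆ (λ α → Valuation.⟦_⟧ σ α ∈ T)
      preimage-closed σ (T , CnT⊆T , _) X⊆σ⁻¹T X⊢α =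
        CnT⊆T (monotone (λ { (_ , α∈X , refl) → X⊆σ⁻¹T α∈X }) (structural σ X⊢α))

      consistent-⊆-proper : ∀ (T : Theory) {X Z} →
        Z ∈ 𝔖 L (Atlas.bundle (lindenbaumAtlas L S) T) →
        X ⊆ Z → Z ⊂ U → ¬ Inconsistent X
      consistent-⊆-proper T (σ , Z⊆ , Z⊇) X⊆Z (_ , U⊈Z) (_ , U⊆CnX) =
        U⊈Z λ u → Z⊇ (preimage-closed σ T (λ α∈X → Z⊆ (X⊆Z α∈X)) (U⊆CnX u))

proposition3p2 : ∀ {ℓ : Level} (L : Language ℓ) (S : AbstractLogic L) →
    IsStructural L S → IsCouniformLogic L S →
    IsCouniformAtlas L (lindenbaumAtlas L S)
proposition3p2 L S structural couniform =
  -- Any theory witnesses nonemptiness of the bundle; this is the inconsistent one.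
  (Cn (λ _ → ⊤) , Cn-isTheory L S _) ,
  λ I X disjoint vars≢U proper →
    let consistent : ¬ Inconsistent (⋃ I X)
        consistent inc =
          let i , Xᵢ-inc = couniform I X disjoint vars≢U inc
              T , Z , Z∈𝔖 , Xᵢ⊆Z , Z⊂U = proper i
          in consistent-⊆-proper L S structural T Z∈𝔖 Xᵢ⊆Z Z⊂U Xᵢ-inc
    in (Cn (⋃ I X) , Cn-isTheory L S _) ,
       Cn (⋃ I X) ,
       -- The preimage of `Cn (⋃ I X)` under the identity is definitionally the same set.
       (identitySubstitution L , id , id) ,
       reflexive ,
       (λ _ → tt) ,
       -- Properness denies `U ⊆ Cn (⋃ I X)`, the only nontrivial half of inconsistency.
       λ U⊆Cn → consistent ((λ _ → tt) , U⊆Cn)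
  where open AbstractLogic S
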